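{- Let $\Phi=\forall u_1\ldots\forall u_n\exists e_1(D_1)\ldots\exists e_m(D_m).\varphi$ be a DQBF. If Algorithm 1 (as described in the context), run on $\Phi$, returns FALSE, then $\Phi$ is false; this holds for every admissible choice made during the run.
   Context: For a set $V$ of variables, $[V]$ is the set of assignments $V\to\{\textsc{true},\textsc{false}\}$; assignments are identified with terms of the literals they make true, $\neg\sigma$ is the clause of the negations of these literals, and $\sigma|_W$ denotes restriction. A DQBF is $\Phi=\forall u_1\ldots\forall u_n\exists e_1(D_1)\ldots\exists e_m(D_m).\varphi$ with pairwise distinct variables, $U=\{u_i\}$, $E=\{e_j\}$, dependency sets $D(e_j)=D_j\subseteq U$, $\varphi$ a CNF over $U\cup E$; a model is a family $(f_e)_{e\in E}$, $f_e:[D(e)]\to\{\textsc{true},\textsc{false}\}$, such that for all $\sigma\in[U]$ the assignment $\sigma$ together with $e\mapsto f_e(\sigma|_{D(e)})$ satisfies $\varphi$; $\Phi$ is true iff it has a model, false otherwise. A definition of a variable $x$ by a set $X$ in a formula $\chi$ is a formula $\psi$ with $\mathit{var}(\psi)\subseteq X$ such that every satisfying assignment $\lambda$ of $\chi$ has $\lambda(x)=\psi[\lambda]$. Arbiter variables $e^\sigma$ ($e\in E$, $\sigma\in[D(e)]$) are fresh variables. Algorithm 1. Phase 1: set $A=\emptyset$, $\varphi_A=\emptyset$, $\psi_{\mathit{Def}}=$ empty conjunction. For $i=1,\dots,m$: while $e_i$ has no definition by $A\cup D_i$ in $\varphi\wedge\varphi_A$, choose $\xi\in[D_i\cup A]$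 such that both $\varphi\wedge\varphi_A\wedge\xi\wedge e_i$ and $\varphi\wedge\varphi_A\wedge\xi\wedge\neg e_i$ are satisfiable, let $\sigma=\xi|_{D_i}$, add $e_i^\sigma$ to $A$ and the clauses $(e_i^\sigma\vee\neg\sigma\vee\neg e_i)$, $(\neg e_i^\sigma\vee\neg\sigma\vee e_i)$ to $\varphi_A$. Then choose a definition $\psi^i$ of $e_i$ by $A\cup D_i$ in $\varphi\wedge\varphi_A$ and conjoin $(e_i\leftrightarrow\psi^i)$ to $\psi_{\mathit{Def}}$. Phase 2: let $\tau\in[A]$ set all arbiter variables true, $\mathcal{C}=\emptyset$. Repeat: if $\neg\varphi\wedge\psi_{\mathit{Def}}\wedge\tau$ is unsatisfiable, return TRUE; otherwise choose a satisfying assignment $\sigma$ of it, choose a subset $\rho$ of the literals of $\tau\wedge\sigma|_U$ with $\varphi\wedge\varphi_A\wedge\rho$ unsatisfiable, add the clause $\neg(\rho|_A)$ to $\mathcal{C}$; if $\mathcal{C}$ is satisfiable, let $\tau\in[A]$ satisfy $\mathcal{C}$ and repeat, else return FALSE. -}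

module Defs where

open import Data.Bool.Base using (Bool; true; false; not; _∧_; _∨_)
open import Data.Fin.Base using (Fin)
open import Data.Fin.Subset using (Subset)
open import Data.Fin.Subset.Properties using (_∈?_)
open import Data.List.Base using (List; []; _∷_; _++_; map; foldr; filter; filterᵇ; allFin)
open import Data.List.Membership.Propositional using (_∈_)
open import Data.List.Relation.Binary.Subset.Propositional using (_⊆_)
open import Data.List.Relation.Unary.All as All using (All)
open import Data.List.Relation.Unary.All.Properties using (map⁻; ++⁻ˡ)
open import Data.List.Relation.Unary.Any using (Any)
open import Data.Nat.Base using (ℕ)
open import Data.Product.Base using (∃; _×_; _,_; proj₁; map₁; map₂)
open import Data.Sum.Base using (_⊎_; [_,_])
open import Function.Base using (_∘_)
open import Relation.Binary.Construct.Closure.ReflexiveTransitive using (Star)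
open import Relation.Binary.PropositionalEquality using (_≡_)
open import Relation.Nullary using (¬_)

infix  9 ¬ᶠ_
infixr 7 _∧ᶠ_
infixr 6 _∨ᶠ_

data Formula (V : Set) : Set where
  var       : V → Formula V
  ⊤ᶠ ⊥ᶠ     : Formula V
  ¬ᶠ_       : Formula V → Formula V
  _∧ᶠ_ _∨ᶠ_ : Formula V → Formula V → Formula V

-- (x , true) is the literal x and (x , false) is the literal ¬x.
Literal Term Clause CNF : Set → Set
Literal V = V × Bool
Term    V = List (Literal V)
Clause  V = List (Literal V)
CNF     V = List (Clause V)

-- An assignment of all variables in V is a function V → Bool.  An assignment
-- of a finite set of variables, listed by W, is an element of Assignment W;
-- unlike a function, it is determined by its values up to _≡_, which matters
-- where assignments index variables or are arguments of model functions.
Assignment : {V : Set} → List V → Set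
Assignment W = All (λ _ → Bool) W

module _ {V : Set} where

  infix 5 _↔ᶠ_
  infix 4 _⊨_ _satisfies_ _↾_

  _↔ᶠ_ : Formula V → Formula V → Formula V
  F ↔ᶠ G = (¬ᶠ F ∨ᶠ G) ∧ᶠ (¬ᶠ G ∨ᶠ F)

  vars : Formula V → List V
  vars (var x)  = x ∷ []
  vars ⊤ᶠ       = []
  vars ⊥ᶠ       = []
  vars (¬ᶠ F)   = vars F
  vars (F ∧ᶠ G) = vars F ++ vars G
  vars (F ∨ᶠ G) = vars F ++ vars G

  eval : (V → Bool) → Formula V → Bool
  eval ν (var x)  = ν x
  eval ν ⊤ᶠ       = true
  eval ν ⊥ᶠ       = false
  eval ν (¬ᶠ F)   = not (eval ν F)
  eval ν (F ∧ᶠ G) = eval ν F ∧ eval ν G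
  eval ν (F ∨ᶠ G) = eval ν F ∨ eval ν G

  _⊨_ : (V → Bool) → Formula V → Set
  ν ⊨ F = eval ν F ≡ true

  Satisfiable : Formula V → Set
  Satisfiable F = ∃ λ ν → ν ⊨ F

  literal : Literal V → Formula V
  literal (x , true)  = var x
  literal (x , false) = ¬ᶠ var x

  term clause : List (Literal V) → Formula V
  term   = foldr (λ l F → literal l ∧ᶠ F) ⊤ᶠ
  clause = foldr (λ l F → literal l ∨ᶠ F) ⊥ᶠ

  cnf : CNF V → Formula V
  cnf = foldr (λ c F → clause c ∧ᶠ F) ⊤ᶠ

  negate : Term V → Clause V
  negate = map (map₂ not)

  literals : {W : List V} → Assignment W → Term V
  literals = All.reduce (λ {x} b → x , b)

  _↾_ : (V → Bool) → (W : List V) → Assignment W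
  ν ↾ W = All.universal ν W

  _satisfies_ : {W : List V} → Assignment W → CNF V → Set
  τ satisfies C = All (Any (_∈ literals τ)) C

  record IsDefinition (x : V) (X : List V) (χ ψ : Formula V) : Set where
    field
      vars⊆   : vars ψ ⊆ X
      defines : ∀ ν → ν ⊨ χ → ν x ≡ eval ν ψ

-- Universal variables are Fin n (inj₁), existential variables are Fin m (inj₂).
record DQBF (n m : ℕ) : Set where
  field
    D      : Fin m → Subset n
    matrix : CNF (Fin n ⊎ Fin m)

  deps : Fin m → List (Fin n)
  deps e = filter (_∈? D e) (allFin n)

  IsModel : ((e : Fin m) → Assignment (deps e) → Bool) → Set
  IsModel f = (σ : Fin n → Bool) → [ σ , (λ e → f e (σ ↾ deps e)) ] ⊨ cnf matrix

  IsTrue IsFalse : Set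
  IsTrue  = ∃ IsModel
  IsFalse = ¬ IsTrue

module Algorithm {n m : ℕ} (Φ : DQBF n m) where
  open DQBF Φ

  data Var : Set where
    univ  : Fin n → Var
    exist : Fin m → Var
    arb   : (e : Fin m) → Assignment (deps e) → Var

  isArbiter : Var → Bool
  isArbiter (univ _)  = false
  isArbiter (exist _) = false
  isArbiter (arb _ _) = true

  φ : Formula Var
  φ = cnf (map (map (map₁ [ univ , exist ])) matrix)

  U : List Var
  U = map univ (allFin n)

  Dᵛ : Fin m → List Var
  Dᵛ e = map univ (deps e)

  restrictD : (e : Fin m) {A : List Var} → Assignment (Dᵛ e ++ A) → Assignment (deps e)
  restrictD e ξ = map⁻ (++⁻ˡ (Dᵛ e) ξ)

  arbiterClauses : (e : Fin m) → Assignment (deps e) → CNF Var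
  arbiterClauses e σ =
    ((arb e σ , true)  ∷ ¬σ ++ (exist e , false) ∷ []) ∷
    ((arb e σ , false) ∷ ¬σ ++ (exist e , true)  ∷ []) ∷ []
    where
    ¬σ : Clause Var
    ¬σ = negate (map (map₁ univ) (literals σ))

  -- In phase₁ the list holds the existential variables still to be processed,
  -- the one at its head being the current e_i.  The list A never receives an
  -- arbiter twice: if e_i^σ is in A, then φ_A ∧ ξ already fixes e_i.
  data State : Set where
    phase₁ : List (Fin m) → (A : List Var) (φA : CNF Var) (ψDef : Formula Var) → State
    phase₂ : (A : List Var) (φA : CNF Var) (ψDef : Formula Var)
             (τ : Assignment A) (C : CNF Var) → State
    return : Bool → State

  initial : State
  initial = phase₁ (allFin m) [] [] ⊤ᶠ

  -- A counterexample σ to the candidate given by τ, and a ρ contained in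
  -- τ ∧ σ|_U that is inconsistent with φ ∧ φ_A.
  record Conflict (A : List Var) (φA : CNF Var) (ψDef : Formula Var) (τ : Assignment A) : Set where
    field
      σ       : Var → Bool
      σ-sat   : σ ⊨ ¬ᶠ φ ∧ᶠ ψDef ∧ᶠ term (literals τ)
      ρ       : Term Var
      ρ⊆      : ρ ⊆ literals τ ++ literals (σ ↾ U)
      ρ-unsat : ¬ Satisfiable (φ ∧ᶠ cnf φA ∧ᶠ term ρ)

    -- ρ|_A is obtained by keeping the arbiter literals: by ρ⊆ the remaining
    -- literals are over U, and A consists of arbiter variables.
    learned : Clause Var
    learned = negate (filterᵇ (isArbiter ∘ proj₁) ρ)

  infix 3 _⟶_

  data _⟶_ : State → State → Set where

    add-arbiter : ∀ {i is A φA ψDef} →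
      ¬ (∃ λ ψ → IsDefinition (exist i) (A ++ Dᵛ i) (φ ∧ᶠ cnf φA) ψ) →
      (ξ : Assignment (Dᵛ i ++ A)) →
      Satisfiable (φ ∧ᶠ cnf φA ∧ᶠ term (literals ξ) ∧ᶠ var (exist i)) →
      Satisfiable (φ ∧ᶠ cnf φA ∧ᶠ term (literals ξ) ∧ᶠ ¬ᶠ var (exist i)) →
      phase₁ (i ∷ is) A φA ψDef ⟶
      phase₁ (i ∷ is) (arb i (restrictD i ξ) ∷ A) (arbiterClauses i (restrictD i ξ) ++ φA) ψDef

    add-definition : ∀ {i is A φA ψDef} (ψ : Formula Var) →
      IsDefinition (exist i) (A ++ Dᵛ i) (φ ∧ᶠ cnf φA) ψ →
      phase₁ (i ∷ is) A φA ψDef ⟶ phase₁ is A φA (ψDef ∧ᶠ (var (exist i) ↔ᶠ ψ))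

    start-phase₂ : ∀ {A φA ψDef} →
      phase₁ [] A φA ψDef ⟶ phase₂ A φA ψDef ((λ _ → true) ↾ A) []

    return-true : ∀ {A φA ψDef τ C} →
      ¬ Satisfiable (¬ᶠ φ ∧ᶠ ψDef ∧ᶠ term (literals τ)) →
      phase₂ A φA ψDef τ C ⟶ return true

    refine : ∀ {A φA ψDef τ C} (K : Conflict A φA ψDef τ) →
      (τ′ : Assignment A) → τ′ satisfies (Conflict.learned K ∷ C) →
      phase₂ A φA ψDef τ C ⟶ phase₂ A φA ψDef τ′ (Conflict.learned K ∷ C)

    return-false : ∀ {A φA ψDef τ C} (K : Conflict A φA ψDef τ) →
      ¬ Satisfiable (cnf (Conflict.learned K ∷ C)) →
      phase₂ A φA ψDef τ C ⟶ return false

  Returns : Bool → Set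
  Returns b = Star _⟶_ initial (return b)

{-# OPTIONS --safe #-}

-- A model f of Φ gives, for every assignment u of the universal variables, an
-- assignment that extends u by the values of f, with e^σ set to f_e(σ).  It
-- satisfies φ ∧ φ_A, and its values on arbiters do not depend on u.  If it
-- violated a learned clause ¬(ρ|_A), then choosing u as the universal part of
-- the counterexample would satisfy φ ∧ φ_A ∧ ρ.  Hence the values f_e(σ)
-- satisfy all learned clauses, and the algorithm cannot return FALSE.
module Submission where

open import Data.Bool.Base using (Bool; true; false; not; _∧_; _∨_; T)
open import Data.Bool.Properties using (_≟_; T?; ¬-not; ∨-zeroʳ)
open import Data.Empty using (⊥; ⊥-elim)
open import Data.Fin.Base using (Fin)
open import Data.List.Base using (List; []; _∷_; _++_; map; filterᵇ; allFin)
open import Data.List.Membership.Propositional using (_∈_)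
open import Data.List.Membership.Propositional.Properties using (∈-++⁻; ∈-filter⁺)
open import Data.List.Relation.Unary.All as All using (All; []; _∷_)
open import Data.List.Relation.Unary.All.Properties using (++⁺; map⁺)
open import Data.List.Relation.Unary.Any using (Any; here; there)
open import Data.List.Relation.Unary.Any.Properties using (++⁺ˡ; ++⁺ʳ)
open import Data.Nat.Base using (ℕ)
open import Data.Product.Base using (_×_; _,_; proj₁; map₁)
open import Data.Sum.Base using (_⊎_; inj₁; inj₂; [_,_]; fromInj₂)
open import Data.Unit.Base using (⊤)
open import Function.Base using (_∘_; const)
open import Relation.Binary.Construct.Closure.ReflexiveTransitive using (Star; ε; _◅_)
open import Relation.Binary.PropositionalEquality using (_≡_; refl; sym; trans; cong; cong₂; _≗_)
open import Relation.Nullary using (yes; no)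
open import Defs

∧-true : ∀ {a b} → a ≡ true → b ≡ true → a ∧ b ≡ true
∧-true = cong₂ _∧_

module _ {V : Set} where

  -- Literal-wise satisfaction makes terms `All` and clauses `Any`, so they can be concatenated,
  -- filtered and searched; the `-sound` lemmas lead back to `eval`.
  Holds : (V → Bool) → Literal V → Set
  Holds ν (x , b) = ν x ≡ b

  HoldsCNF : (V → Bool) → CNF V → Set
  HoldsCNF ν = All (Any (Holds ν))

  literal-sound : ∀ ν (l : Literal V) → Holds ν l → ν ⊨ literal l
  literal-sound ν (x , true)  h = h
  literal-sound ν (x , false) h = cong not h

  term-sound : ∀ ν {t : Term V} → All (Holds ν) t → ν ⊨ term t
  term-sound ν []       = refl
  term-sound ν (h ∷ hs) = ∧-true (literal-sound ν _ h) (term-sound ν hs)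

  clause-sound : ∀ ν {c : Clause V} → Any (Holds ν) c → ν ⊨ clause c
  clause-sound ν {_ ∷ c} (here h) = cong (_∨ eval ν (clause c)) (literal-sound ν _ h)
  clause-sound ν {l ∷ c} (there h) =
    trans (cong (eval ν (literal l) ∨_) (clause-sound ν h)) (∨-zeroʳ _)

  cnf-sound : ∀ ν {C : CNF V} → HoldsCNF ν C → ν ⊨ cnf C
  cnf-sound ν []       = refl
  cnf-sound ν (h ∷ hs) = ∧-true (clause-sound ν h) (cnf-sound ν hs)

  -- Constructive because literals are decidable. Used with `t` the literals of some `σ` for arbiter
  -- clauses, and with `t` the arbiter part of `ρ` for learned clauses.
  holds-or-negate : ∀ ν (t : Term V) → All (Holds ν) t ⊎ Any (Holds ν) (negate t)
  holds-or-negate ν [] = inj₁ []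
  holds-or-negate ν ((x , b) ∷ t) with ν x ≟ b | holds-or-negate ν t
  ... | no  h | _      = inj₂ (here (¬-not h))
  ... | yes _ | inj₂ k = inj₂ (there k)
  ... | yes h | inj₁ k = inj₁ (h ∷ k)

  literals-All : ∀ {P : V → Set} {W} (τ : Assignment W) →
                 All P W → All (P ∘ proj₁) (literals τ)
  literals-All []      []       = []
  literals-All (_ ∷ τ) (p ∷ ps) = p ∷ literals-All τ ps

  restrict-holds : ∀ {ν σ : V → Bool} {W} →
                   All (λ x → ν x ≡ σ x) W → All (Holds ν) (literals (σ ↾ W))
  restrict-holds []       = []
  restrict-holds (h ∷ hs) = h ∷ restrict-holds hs

module _ {V W : Set} (g : V → W) {ν : W → Bool} {μ : V → Bool} (ν∘g≗μ : ν ∘ g ≗ μ) where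

  eval-literal-map : ∀ l → eval ν (literal (map₁ g l)) ≡ eval μ (literal l)
  eval-literal-map (x , true)  = ν∘g≗μ x
  eval-literal-map (x , false) = cong not (ν∘g≗μ x)

  eval-clause-map : ∀ c → eval ν (clause (map (map₁ g) c)) ≡ eval μ (clause c)
  eval-clause-map []      = refl
  eval-clause-map (l ∷ c) = cong₂ _∨_ (eval-literal-map l) (eval-clause-map c)

  eval-cnf-map : ∀ C → eval ν (cnf (map (map (map₁ g)) C)) ≡ eval μ (cnf C)
  eval-cnf-map []      = refl
  eval-cnf-map (c ∷ C) = cong₂ _∧_ (eval-clause-map c) (eval-cnf-map C)

  -- Agreement literal by literal becomes an equality of assignments, which can then be rewritten
  -- under a model function.
  holds-literals⇒restrict : ∀ {X} (σ : Assignment X) →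
    All (Holds ν) (map (map₁ g) (literals σ)) → (μ ↾ X) ≡ σ
  holds-literals⇒restrict []      []       = refl
  holds-literals⇒restrict (_ ∷ σ) (h ∷ hs) =
    cong₂ _∷_ (trans (sym (ν∘g≗μ _)) h) (holds-literals⇒restrict σ hs)

module Soundness {n m : ℕ} (Φ : DQBF n m)
                 (f : (e : Fin m) → Assignment (DQBF.deps Φ e) → Bool)
                 (f-model : DQBF.IsModel Φ f) where
  open DQBF Φ
  open Algorithm Φ

  extend : (Fin n → Bool) → Var → Bool
  extend u (univ x)  = u x
  extend u (exist e) = f e (u ↾ deps e)
  extend u (arb e σ) = f e σ

  extend-arbiter : ∀ u v x → T (isArbiter x) → extend u x ≡ extend v x
  extend-arbiter u v (arb e σ) _ = refl

  extend-⊨-φ : ∀ u → extend u ⊨ φ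
  extend-⊨-φ u = trans (eval-cnf-map [ univ , exist ] agree matrix) (f-model u)
    where
    agree : extend u ∘ [ univ , exist ] ≗ [ u , (λ e → f e (u ↾ deps e)) ]
    agree (inj₁ _) = refl
    agree (inj₂ _) = refl

  -- If `u` differs from `σ` on the dependencies of `e`, a literal of the negated `σ` holds.
  -- Otherwise `e` and its arbiter both take the value `f e σ`. The two clauses differ only in the
  -- sign `b`.
  arbiterClauses-hold : ∀ u e σ → HoldsCNF (extend u) (arbiterClauses e σ)
  arbiterClauses-hold u e σ = clause-holds true ∷ clause-holds false ∷ []
    where
    t : Term Var
    t = map (map₁ univ) (literals σ)

    clause-holds : ∀ b → Any (Holds (extend u))
                         ((arb e σ , b) ∷ negate t ++ (exist e , not b) ∷ [])
    clause-holds b with f e σ ≟ b | holds-or-negate (extend u) t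
    ... | yes h | _      = here h
    ... | no  _ | inj₂ k = there (++⁺ˡ k)
    -- Here `u` restricts to `σ`, so `exist e` has the value `f e σ`, which is not `b`.
    ... | no  h | inj₁ k = there (++⁺ʳ (negate t) (here
      (trans (cong (f e) (holds-literals⇒restrict univ (λ _ → refl) σ k)) (¬-not h))))

  -- The quantifier over `u` lets `learned-holds` move from a given `u` to the universal part of a
  -- counterexample.
  HoldsUniformly : CNF Var → Set
  HoldsUniformly C = ∀ u → HoldsCNF (extend u) C

  AllArbiters : List Var → Set
  AllArbiters = All (T ∘ isArbiter)

  learned-holds : ∀ {A φA ψDef τ} → AllArbiters A → HoldsUniformly φA →
                  (K : Conflict A φA ψDef τ) → ∀ u → Any (Holds (extend u)) (Conflict.learned K)
  learned-holds {φA = φA} {τ = τ} arbs hA K u =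
    fromInj₂ (λ h → ⊥-elim (ρ-unsat (extend v , extend-⊨ h)))
      (holds-or-negate (extend u) (filterᵇ (isArbiter ∘ proj₁) ρ))
    where
    open Conflict K

    v : Fin n → Bool
    v = σ ∘ univ

    universal-holds : All (Holds (extend v)) (literals (σ ↾ U))
    universal-holds = restrict-holds (map⁺ (All.universal (λ _ → refl) (allFin n)))

    module _ (h : All (Holds (extend u)) (filterᵇ (isArbiter ∘ proj₁) ρ)) where

      ρ-holds : ∀ {l} → l ∈ ρ → Holds (extend v) l
      -- A literal from `σ ↾ U` holds by the choice of `v`. One from `τ` is an arbiter literal, so
      -- it survives the filter; `h` gives its value under `extend u`, and `extend v` agrees there.
      ρ-holds {x , b} l∈ρ with ∈-++⁻ (literals τ) (ρ⊆ l∈ρ)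
      ... | inj₂ l∈σ = All.lookup universal-holds l∈σ
      ... | inj₁ l∈τ = trans (extend-arbiter v u x arbiter)
                             (All.lookup h (∈-filter⁺ (T? ∘ isArbiter ∘ proj₁) l∈ρ arbiter))
        where
        arbiter : T (isArbiter x)
        arbiter = All.lookup (literals-All τ arbs) l∈τ

      extend-⊨ : extend v ⊨ φ ∧ᶠ cnf φA ∧ᶠ term ρ
      extend-⊨ = ∧-true (extend-⊨-φ v)
        (∧-true (cnf-sound (extend v) (hA v)) (term-sound (extend v) (All.tabulate ρ-holds)))

  -- Sending `return false` to `⊥` makes preservation along a run the whole soundness argument.
  Invariant : State → Set
  Invariant (phase₁ _ A φA _)   = AllArbiters A × HoldsUniformly φA
  Invariant (phase₂ A φA _ _ C) = AllArbiters A × HoldsUniformly φA × HoldsUniformly C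
  Invariant (return true)       = ⊤
  Invariant (return false)      = ⊥

  step-preserves : ∀ {s t} → s ⟶ t → Invariant s → Invariant t
  step-preserves (add-arbiter {i} _ ξ _ _) (arbs , hA) =
    (_ ∷ arbs) , λ u → ++⁺ (arbiterClauses-hold u i (restrictD i ξ)) (hA u)
  step-preserves (add-definition _ _) inv              = inv
  step-preserves start-phase₂         (arbs , hA)      = arbs , hA , λ _ → []
  step-preserves (return-true _)      _                = _
  step-preserves (refine K _ _)       (arbs , hA , hC) =
    arbs , hA , λ u → learned-holds arbs hA K u ∷ hC u
  step-preserves (return-false K unsat) (arbs , hA , hC) =
    unsat (extend u , cnf-sound (extend u) (learned-holds arbs hA K u ∷ hC u))
    where
    u : Fin n → Bool
    -- An arbitrary choice: the clauses hold under `extend u` for every `u`.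
    u = const true

  run-preserves : ∀ {s t} → Star _⟶_ s t → Invariant s → Invariant t
  run-preserves ε        inv = inv
  run-preserves (r ◅ rs) inv = run-preserves rs (step-preserves r inv)

theorem2 : (n m : ℕ) (Φ : DQBF n m) → Algorithm.Returns Φ false → DQBF.IsFalse Φ
theorem2 n m Φ run (f , f-model) = run-preserves run ([] , λ _ → [])
  where open Soundness Φ f f-model
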